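{- For every finite simple graph $G$ on $n$ vertices, $\alpha_{1}(G) + \tau_{B}(G) \le \frac{4403 n^2}{15000}$.
   Context: All graphs are finite, simple and undirected. A triangle-independent set in $G$ is a set of edges containing at most one edge from each triangle of $G$; $\alpha_{1}(G)$ denotes the maximum size of a triangle-independent set in $G$. $\tau_{B}(G)$ denotes the minimum size of a set of edges whose deletion from $G$ leaves a bipartite graph. -}

module Defs where

open import Data.Nat using (ℕ; _+_; _*_; _≤_)
open import Data.Bool using (Bool; true; false; _∧_; if_then_else_)
open import Data.Fin using (Fin; _<?_)
open import Data.List using (List; map; allFin; concatMap)
open import Data.Nat.ListAction using (sum)
open import Data.Product using (Σ; _×_; ∃)
open import Relation.Nullary.Decidable using (⌊_⌋)
open import Relation.Binary.PropositionalEquality using (_≡_; _≢_)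

record Graph (n : ℕ) : Set where
  field
    adj    : Fin n → Fin n → Bool
    sym    : ∀ i j → adj i j ≡ adj j i
    irrefl : ∀ i → adj i i ≡ false
open Graph public

record EdgeSet {n : ℕ} (G : Graph n) : Set where
  field
    mem    : Fin n → Fin n → Bool
    memSym : ∀ i j → mem i j ≡ mem j i
    sub    : ∀ i j → mem i j ≡ true → adj G i j ≡ true
open EdgeSet public

b2n : Bool → ℕ
b2n true  = 1
b2n false = 0

size : ∀ {n} {G : Graph n} → EdgeSet G → ℕ
size {n} S = sum (concatMap (λ i → map (λ j → b2n (⌊ i <? j ⌋ ∧ mem S i j)) (allFin n)) (allFin n))

TriangleIndependent : ∀ {n} {G : Graph n} → EdgeSet G → Set
TriangleIndependent {n} {G} S =
  ∀ a b c → adj G a b ≡ true → adj G b c ≡ true → adj G a c ≡ true →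
  b2n (mem S a b) + b2n (mem S b c) + b2n (mem S a c) ≤ 1

BipartiteAfterDeleting : ∀ {n} {G : Graph n} → EdgeSet G → Set
BipartiteAfterDeleting {n} {G} D =
  Σ (Fin n → Bool) λ col → ∀ i j → adj G i j ≡ true → mem D i j ≡ false →
    col i ≢ col j

IsAlpha1 : ∀ {n} → Graph n → ℕ → Set
IsAlpha1 G a =
  (Σ (EdgeSet G) λ S → TriangleIndependent S × size S ≡ a) ×
  (∀ (S : EdgeSet G) → TriangleIndependent S → size S ≤ a)

IsTauB : ∀ {n} → Graph n → ℕ → Set
IsTauB G t =
  (Σ (EdgeSet G) λ D → BipartiteAfterDeleting D × size D ≡ t) ×
  (∀ (D : EdgeSet G) → BipartiteAfterDeleting D → t ≤ size D)

{-# OPTIONS --safe #-}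

-- Let F be triangle-independent; colour the pairs of F red, the other edges
-- blue, all remaining pairs (and the diagonal) none. Some cut satisfies
-- |F| + #(uncut edges) ≤ n²/4. For a vertex v, put the red neighbours of v on
-- one side and its non-neighbours on the other, and split the blue neighbours
-- by a cut obtained inductively, in one of its two orientations. Averaged over v
-- and the orientation, the slack n²/4 − |F| − #(uncut edges) is at least a
-- multiple of ∑ᵥ (r(v) − z(v))² plus a sum over triples of vertices whose
-- symmetrisation is nonnegative for each admissible colouring of a triangle;
-- here r(v) and z(v) count the red neighbours and the non-neighbours of v.
module Submission where

open import Defs renaming (sym to adj-sym)
open import Data.Nat using (ℕ; _+_; _*_; _≤_; _<_; _≰_; z≤n; s≤s)
import Data.Nat.Properties as ℕ
open import Data.Nat.ListAction using (sum)
open import Data.Nat.ListAction.Properties using (sum-++)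
open import Data.Nat.Induction using (<-wellFounded)
open import Induction.WellFounded using (Acc; acc)
open import Data.Integer as ℤ using (ℤ; +_; 0ℤ; 1ℤ; +≤+)
import Data.Integer.Properties as ℤ
open import Data.Integer.Tactic.RingSolver using (solve-∀)
open import Data.Bool using (Bool; true; false; not; _∧_; _xor_)
open import Data.Fin as Fin using (Fin; _<?_)
import Data.Fin.Properties as Fin
open import Data.List using (List; []; _∷_; map; concatMap; filter; length; allFin)
open import Data.List.Properties using (filter-notAll; length-tabulate)
open import Data.List.Membership.Propositional using (_∈_)
open import Data.List.Relation.Unary.Any as Any using (here; there)
open import Data.Product using (∃; _×_; _,_)
open import Data.Sum using (_⊎_; inj₁; inj₂; [_,_]′)
open import Function using (id)
open import Relation.Nullary using (Dec; yes; no; does; contradiction)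
open import Relation.Nullary.Decidable using (⌊_⌋; toWitness; _→-dec_)
open import Relation.Unary using (Decidable)
open import Relation.Binary.PropositionalEquality

private variable
  A B : Set

-- Finite sums of integers

∑ : List A → (A → ℤ) → ℤ
∑ []       f = 0ℤ
∑ (x ∷ xs) f = f x ℤ.+ ∑ xs f

∑-cong : ∀ (xs : List A) {f g : A → ℤ} → (∀ x → f x ≡ g x) → ∑ xs f ≡ ∑ xs g
∑-cong []       eq = refl
∑-cong (x ∷ xs) eq = cong₂ ℤ._+_ (eq x) (∑-cong xs eq)

∑-mono : ∀ (xs : List A) {f g : A → ℤ} → (∀ x → f x ℤ.≤ g x) → ∑ xs f ℤ.≤ ∑ xs g
∑-mono []       le = ℤ.≤-refl
∑-mono (x ∷ xs) le = ℤ.+-mono-≤ (le x) (∑-mono xs le)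

∑-nonneg : ∀ (xs : List A) {f : A → ℤ} → (∀ x → 0ℤ ℤ.≤ f x) → 0ℤ ℤ.≤ ∑ xs f
∑-nonneg []       le = ℤ.≤-refl
∑-nonneg (x ∷ xs) le = ℤ.+-mono-≤ (le x) (∑-nonneg xs le)

∑-zero : ∀ (xs : List A) → ∑ xs (λ _ → 0ℤ) ≡ 0ℤ
∑-zero []       = refl
∑-zero (x ∷ xs) = trans (ℤ.+-identityˡ _) (∑-zero xs)

∑-one : ∀ (xs : List A) → ∑ xs (λ _ → 1ℤ) ≡ + length xs
∑-one []       = refl
∑-one (x ∷ xs) = cong (ℤ._+_ 1ℤ) (∑-one xs)

∑-+ : ∀ (xs : List A) (f g : A → ℤ) → ∑ xs (λ x → f x ℤ.+ g x) ≡ ∑ xs f ℤ.+ ∑ xs g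
∑-+ []       f g = refl
∑-+ (x ∷ xs) f g = trans (cong (ℤ._+_ (f x ℤ.+ g x)) (∑-+ xs f g)) (interchange (f x) (g x) (∑ xs f) (∑ xs g))
  where
  interchange : ∀ a b c d → (a ℤ.+ b) ℤ.+ (c ℤ.+ d) ≡ (a ℤ.+ c) ℤ.+ (b ℤ.+ d)
  interchange = solve-∀

∑-*ˡ : ∀ (xs : List A) k (f : A → ℤ) → ∑ xs (λ x → k ℤ.* f x) ≡ k ℤ.* ∑ xs f
∑-*ˡ []       k f = sym (ℤ.*-zeroʳ k)
∑-*ˡ (x ∷ xs) k f = trans (cong (ℤ._+_ (k ℤ.* f x)) (∑-*ˡ xs k f)) (sym (ℤ.*-distribˡ-+ k (f x) (∑ xs f)))

∑-*ʳ : ∀ (xs : List A) k (f : A → ℤ) → ∑ xs (λ x → f x ℤ.* k) ≡ ∑ xs f ℤ.* k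
∑-*ʳ xs k f = trans (∑-cong xs λ x → ℤ.*-comm (f x) k) (trans (∑-*ˡ xs k f) (ℤ.*-comm k (∑ xs f)))

∑-swap : ∀ (xs : List A) (ys : List B) (f : A → B → ℤ) →
  ∑ xs (λ x → ∑ ys (f x)) ≡ ∑ ys (λ y → ∑ xs (λ x → f x y))
∑-swap []       ys f = sym (∑-zero ys)
∑-swap (x ∷ xs) ys f = trans (cong (ℤ._+_ (∑ ys (f x))) (∑-swap xs ys f)) (sym (∑-+ ys (f x) _))

∑-filter : ∀ {P : A → Set} (P? : Decidable P) (xs : List A) (f : A → ℤ) →
  ∑ (filter P? xs) f ≡ ∑ xs (λ x → + b2n (does (P? x)) ℤ.* f x)
∑-filter P? []       f = refl
∑-filter P? (x ∷ xs) f with does (P? x)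
... | true  = cong₂ ℤ._+_ (sym (ℤ.*-identityˡ (f x))) (∑-filter P? xs f)
... | false = trans (∑-filter P? xs f) (sym (ℤ.+-identityˡ _))

0≤+⇒0≤⊎0≤ : ∀ i j → 0ℤ ℤ.≤ i ℤ.+ j → 0ℤ ℤ.≤ i ⊎ 0ℤ ℤ.≤ j
0≤+⇒0≤⊎0≤ i j 0≤i+j with 0ℤ ℤ.≤? i | 0ℤ ℤ.≤? j
... | yes 0≤i | _       = inj₁ 0≤i
... | _       | yes 0≤j = inj₂ 0≤j
... | no 0≰i  | no 0≰j  = contradiction 0≤i+j (ℤ.<⇒≱ (ℤ.+-mono-< (ℤ.≰⇒> 0≰i) (ℤ.≰⇒> 0≰j)))

-- Averaging, used to pick the vertex `v`. Membership of the witness is returned because the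
-- induction must know that `v` lies in the list.
∑-nonneg⇒∃ : ∀ x (xs : List A) (f : A → ℤ) → 0ℤ ℤ.≤ ∑ (x ∷ xs) f →
  ∃ λ y → y ∈ x ∷ xs × 0ℤ ℤ.≤ f y
∑-nonneg⇒∃ x []        f 0≤∑ = x , here refl , subst (0ℤ ℤ.≤_) (ℤ.+-identityʳ (f x)) 0≤∑
∑-nonneg⇒∃ x (x′ ∷ xs) f 0≤∑ with 0≤+⇒0≤⊎0≤ (f x) _ 0≤∑
... | inj₁ 0≤fx = x , here refl , 0≤fx
... | inj₂ 0≤∑′ with y , y∈ , 0≤fy ← ∑-nonneg⇒∃ x′ xs f 0≤∑′ = y , there y∈ , 0≤fy

∑₂ : List A → (A → A → ℤ) → ℤ
∑₂ xs f = ∑ xs λ x → ∑ xs (f x)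

∑₂-cong : ∀ (xs : List A) {f g : A → A → ℤ} → (∀ x y → f x y ≡ g x y) → ∑₂ xs f ≡ ∑₂ xs g
∑₂-cong xs eq = ∑-cong xs λ x → ∑-cong xs (eq x)

∑₂-mono : ∀ (xs : List A) {f g : A → A → ℤ} → (∀ x y → f x y ℤ.≤ g x y) → ∑₂ xs f ℤ.≤ ∑₂ xs g
∑₂-mono xs le = ∑-mono xs λ x → ∑-mono xs (le x)

∑₂-+ : ∀ (xs : List A) (f g : A → A → ℤ) → ∑₂ xs (λ x y → f x y ℤ.+ g x y) ≡ ∑₂ xs f ℤ.+ ∑₂ xs g
∑₂-+ xs f g = trans (∑-cong xs λ x → ∑-+ xs (f x) (g x)) (∑-+ xs _ _)

∑₂-*ˡ : ∀ (xs : List A) k (f : A → A → ℤ) → ∑₂ xs (λ x y → k ℤ.* f x y) ≡ k ℤ.* ∑₂ xs f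
∑₂-*ˡ xs k f = trans (∑-cong xs λ x → ∑-*ˡ xs k (f x)) (∑-*ˡ xs k _)

∑₂-product : ∀ (xs : List A) (f g : A → ℤ) → ∑₂ xs (λ x y → f x ℤ.* g y) ≡ ∑ xs f ℤ.* ∑ xs g
∑₂-product xs f g = trans (∑-cong xs λ x → ∑-*ˡ xs (f x) g) (∑-*ʳ xs (∑ xs g) f)

∑₂-filter : ∀ {P : A → Set} (P? : Decidable P) (xs : List A) (f : A → A → ℤ) →
  ∑₂ (filter P? xs) f ≡ ∑₂ xs (λ x y → + b2n (does (P? x)) ℤ.* (+ b2n (does (P? y)) ℤ.* f x y))
∑₂-filter P? xs f = trans (∑-filter P? xs _)
  (∑-cong xs λ x → trans (cong (ℤ._*_ (+ b2n (does (P? x)))) (∑-filter P? xs (f x)))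
                         (sym (∑-*ˡ xs (+ b2n (does (P? x))) _)))

∑₃ : List A → (A → A → A → ℤ) → ℤ
∑₃ xs f = ∑ xs λ x → ∑₂ xs (f x)

∑₃-+ : ∀ (xs : List A) (f g : A → A → A → ℤ) →
  ∑₃ xs (λ x y z → f x y z ℤ.+ g x y z) ≡ ∑₃ xs f ℤ.+ ∑₃ xs g
∑₃-+ xs f g = trans (∑-cong xs λ x → ∑₂-+ xs (f x) (g x)) (∑-+ xs _ _)

∑₃-rotate : ∀ (xs : List A) (f : A → A → A → ℤ) → ∑₃ xs (λ x y z → f y z x) ≡ ∑₃ xs f
∑₃-rotate xs f = trans (∑-swap xs xs _) (∑-cong xs λ y → ∑-swap xs xs _)

0≤3i⇒0≤i : ∀ i → 0ℤ ℤ.≤ i ℤ.+ i ℤ.+ i → 0ℤ ℤ.≤ i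
0≤3i⇒0≤i i le = ℤ.*-cancelˡ-≤-pos 0ℤ i (+ 3) (subst (0ℤ ℤ.≤_) (triple i) le)
  where
  triple : ∀ i → i ℤ.+ i ℤ.+ i ≡ + 3 ℤ.* i
  triple = solve-∀

-- Rotating the arguments leaves the triple sum unchanged, so three times the sum of `f` is the sum
-- of its cyclic symmetrisation. Single values of `f` may be negative.
∑₃-cyclic-nonneg : ∀ (xs : List A) (f : A → A → A → ℤ) →
  (∀ x y z → 0ℤ ℤ.≤ f x y z ℤ.+ f y z x ℤ.+ f z x y) → 0ℤ ℤ.≤ ∑₃ xs f
∑₃-cyclic-nonneg xs f le = 0≤3i⇒0≤i (∑₃ xs f) (subst (0ℤ ℤ.≤_) eq
  (∑-nonneg xs λ x → ∑-nonneg xs λ y → ∑-nonneg xs λ z → le x y z))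
  where
  open ≡-Reasoning
  f′ f″ : _ → _ → _ → ℤ
  f′ x y z = f y z x
  f″ x y z = f z x y
  eq : ∑₃ xs (λ x y z → f x y z ℤ.+ f y z x ℤ.+ f z x y) ≡ ∑₃ xs f ℤ.+ ∑₃ xs f ℤ.+ ∑₃ xs f
  eq = begin
    ∑₃ xs (λ x y z → f x y z ℤ.+ f′ x y z ℤ.+ f″ x y z)
      ≡⟨ ∑₃-+ xs (λ x y z → f x y z ℤ.+ f′ x y z) f″ ⟩
    ∑₃ xs (λ x y z → f x y z ℤ.+ f′ x y z) ℤ.+ ∑₃ xs f″
      ≡⟨ cong₂ ℤ._+_ (∑₃-+ xs f f′) (sym (∑₃-rotate xs f″)) ⟩
    ∑₃ xs f ℤ.+ ∑₃ xs f′ ℤ.+ ∑₃ xs f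
      ≡⟨ cong (λ s → ∑₃ xs f ℤ.+ s ℤ.+ ∑₃ xs f) (∑₃-rotate xs f) ⟩
    ∑₃ xs f ℤ.+ ∑₃ xs f ℤ.+ ∑₃ xs f ∎

0≤i*i : ∀ i → 0ℤ ℤ.≤ i ℤ.* i
0≤i*i (+ n)      = subst (0ℤ ℤ.≤_) (ℤ.pos-* n n) (+≤+ z≤n)
0≤i*i ℤ.-[1+ n ] = +≤+ z≤n

-- Colourings of pairs and the local inequality

Colour : Set
Colour = Fin 3

pattern red  = Fin.zero
pattern blue = Fin.suc Fin.zero
pattern none = Fin.suc (Fin.suc Fin.zero)

is : Colour → Colour → ℤ
is k p = + b2n (does (p Fin.≟ k))

isEdge : Colour → ℤ
isEdge p = 1ℤ ℤ.- is none p

agree : Bool → Bool → Bool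
agree a b = not (a xor b)

-- Summed over ordered pairs this gives n² − 4 |F| − 4 #(uncut edges).
pairSlack : Colour → Bool → Bool → ℤ
pairSlack s a b = 1ℤ ℤ.- + 2 ℤ.* is red s ℤ.- + 2 ℤ.* (isEdge s ℤ.* + b2n (agree a b))

-- `o` is the orientation and `a` the side chosen by the inductive cut. Since the diagonal is
-- coloured `none`, `v` is placed with its non-neighbours.
side : Bool → Colour → Bool → Bool
side o red  a = true
side o blue a = a xor o
side o none a = false

-- Contribution of a pair coloured s to the total slack of the two orientations
-- of the cut of v, less the slack of the inductive cut counted twice; p and q are
-- the colours joining v to the two ends of the pair.
gain : Colour → Colour → Colour → ℤ
gain p q s = + 2 ℤ.- + 4 ℤ.* is red s
  ℤ.- isEdge s ℤ.* (+ 4 ℤ.* (is red p ℤ.* is red q) ℤ.+ + 4 ℤ.* (is none p ℤ.* is none q)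
                    ℤ.+ + 2 ℤ.* (is blue p ℤ.* (1ℤ ℤ.- is blue q))
                    ℤ.+ + 2 ℤ.* ((1ℤ ℤ.- is blue p) ℤ.* is blue q))
  ℤ.- + 2 ℤ.* (is blue p ℤ.* is blue q) ℤ.+ + 4 ℤ.* (is blue p ℤ.* is blue q ℤ.* is red s)

Orientations : Bool → Bool → Colour → Colour → Colour → Set
Orientations a b p q s =
  pairSlack s (side false p a) (side false q b) ℤ.+ pairSlack s (side true p a) (side true q b)
  ≡ gain p q s ℤ.+ + 2 ℤ.* (is blue p ℤ.* (is blue q ℤ.* pairSlack s a b))

orientations? : ∀ a b → Dec (∀ p q s → Orientations a b p q s)
orientations? a b = Fin.all? λ p → Fin.all? λ q → Fin.all? λ s → _ ℤ.≟ _

-- A finite check. A pair with both ends blue to `v` keeps its inductive status in both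
-- orientations, a pair with exactly one such end is cut in exactly one of them, and any other pair
-- is treated alike in both.
orientations : ∀ a b p q s → Orientations a b p q s
orientations true  true  = toWitness {a? = orientations? true true} _
orientations true  false = toWitness {a? = orientations? true false} _
orientations false true  = toWitness {a? = orientations? false true} _
orientations false false = toWitness {a? = orientations? false false} _

-- Summed over `x`, the value at `c v x` is r(v) - z(v).
imbalance : Colour → ℤ
imbalance p = is red p ℤ.- is none p

-- The cyclic sum of `gain` is -2 on triangles with colours red, red, none or red, none, none.
-- Subtracting the products raises both to 0.
surplus : Colour → Colour → Colour → ℤ
surplus p q s = gain p q s ℤ.- + 2 ℤ.* (imbalance p ℤ.* imbalance q)

-- For a triangle v, x, y with `p`, `q`, `s` on vx, vy, xy, the three terms are the views from v, x
-- and y. The premises say that two red sides force the third to be `none`.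
CyclicNonneg : Colour → Colour → Colour → Set
CyclicNonneg p q s =
  (p ≡ red → q ≡ red → s ≡ none) → (s ≡ red → p ≡ red → q ≡ none) →
  (q ≡ red → s ≡ red → p ≡ none) →
  0ℤ ℤ.≤ surplus p q s ℤ.+ surplus s p q ℤ.+ surplus q s p

cyclicNonneg? : ∀ p q s → Dec (CyclicNonneg p q s)
cyclicNonneg? p q s =
  (p Fin.≟ red →-dec q Fin.≟ red →-dec s Fin.≟ none) →-dec
  (s Fin.≟ red →-dec p Fin.≟ red →-dec q Fin.≟ none) →-dec
  (q Fin.≟ red →-dec s Fin.≟ red →-dec p Fin.≟ none) →-dec
  (0ℤ ℤ.≤? surplus p q s ℤ.+ surplus s p q ℤ.+ surplus q s p)

-- A finite check: on admissible triangles the cyclic sum is 2 if all three colours occur and 0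
-- otherwise.
surplus-cyclic-nonneg : ∀ p q s → CyclicNonneg p q s
surplus-cyclic-nonneg =
  toWitness {a? = Fin.all? λ p → Fin.all? λ q → Fin.all? (cyclicNonneg? p q)} _

-- Existence of a good cut

module Cut
  (c : A → A → Colour)
  (c-sym : ∀ x y → c x y ≡ c y x)
  (c-diag : ∀ x → c x x ≡ none)
  (c-tri : ∀ x y z → c x y ≡ red → c x z ≡ red → c y z ≡ none)
  where

  slack : List A → (A → Bool) → ℤ
  slack xs χ = ∑₂ xs λ x y → pairSlack (c x y) (χ x) (χ y)

  blueNbrs : A → List A → List A
  blueNbrs v = filter λ x → c v x Fin.≟ blue

  totalGain : List A → A → ℤ
  totalGain xs v = ∑₂ xs λ x y → gain (c v x) (c v y) (c x y)

  surplus-sum-nonneg : ∀ xs → 0ℤ ℤ.≤ ∑₃ xs (λ v x y → surplus (c v x) (c v y) (c x y))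
  surplus-sum-nonneg xs = ∑₃-cyclic-nonneg xs _ λ v x y →
    subst (0ℤ ℤ.≤_)
      -- The rotated terms read the pairs as `c x v`, `c y v` and `c y x`; symmetry of `c` matches
      -- them with the local inequality.
      (cong₂ (λ a b → surplus (c v x) (c v y) (c x y) ℤ.+ a ℤ.+ b)
        (cong₂ (surplus (c x y)) (c-sym v x) (c-sym v y))
        (cong₂ (λ a b → surplus a b (c v x)) (c-sym v y) (c-sym x y)))
      (surplus-cyclic-nonneg (c v x) (c v y) (c x y)
        (c-tri v x y)
        (λ xy vx → c-tri x v y (trans (c-sym x v) vx) xy)
        (λ vy xy → trans (c-sym v x) (c-tri y x v (trans (c-sym y x) xy) (trans (c-sym y v) vy))))

  totalGain-sum-nonneg : ∀ xs → 0ℤ ℤ.≤ ∑ xs (totalGain xs)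
  totalGain-sum-nonneg xs = ℤ.≤-trans (surplus-sum-nonneg xs) (∑-mono xs bound)
    where
    open ℤ.≤-Reasoning
    add-back : ∀ a b → a ≡ (a ℤ.- b) ℤ.+ b
    add-back = solve-∀
    bound : ∀ v → ∑₂ xs (λ x y → surplus (c v x) (c v y) (c x y)) ℤ.≤ totalGain xs v
    bound v = begin
      S                                ≡⟨ ℤ.+-identityʳ S ⟨
      -- The products removed in `surplus` add up to twice the square of r(v) - z(v), so restoring
      -- them can only increase the sum.
      S ℤ.+ + 2 ℤ.* 0ℤ                 ≤⟨ ℤ.+-monoʳ-≤ S (ℤ.*-monoˡ-≤-nonNeg (+ 2) (0≤i*i (∑ xs d))) ⟩
      S ℤ.+ + 2 ℤ.* (∑ xs d ℤ.* ∑ xs d)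
        ≡⟨ cong (λ t → S ℤ.+ + 2 ℤ.* t) (∑₂-product xs d d) ⟨
      S ℤ.+ + 2 ℤ.* ∑₂ xs (λ x y → d x ℤ.* d y)
        ≡⟨ cong (ℤ._+_ S) (∑₂-*ˡ xs (+ 2) (λ x y → d x ℤ.* d y)) ⟨
      S ℤ.+ ∑₂ xs (λ x y → + 2 ℤ.* (d x ℤ.* d y))
        ≡⟨ ∑₂-+ xs (λ x y → surplus (c v x) (c v y) (c x y)) (λ x y → + 2 ℤ.* (d x ℤ.* d y)) ⟨
      ∑₂ xs (λ x y → surplus (c v x) (c v y) (c x y) ℤ.+ + 2 ℤ.* (d x ℤ.* d y))
        ≡⟨ ∑₂-cong xs (λ x y → sym (add-back (gain (c v x) (c v y) (c x y)) (+ 2 ℤ.* (d x ℤ.* d y)))) ⟩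
      totalGain xs v ∎
      where
      d : A → ℤ
      d x = imbalance (c v x)
      S : ℤ
      S = ∑₂ xs (λ x y → surplus (c v x) (c v y) (c x y))

  extend : Bool → A → (A → Bool) → A → Bool
  extend o v χ x = side o (c v x) (χ x)

  slack-extend : ∀ xs v χ →
    slack xs (extend false v χ) ℤ.+ slack xs (extend true v χ)
    ≡ totalGain xs v ℤ.+ + 2 ℤ.* slack (blueNbrs v xs) χ
  slack-extend xs v χ = begin
    slack xs (extend false v χ) ℤ.+ slack xs (extend true v χ)
      ≡⟨ ∑₂-+ xs _ _ ⟨
    ∑₂ xs (λ x y → pairSlack (c x y) (extend false v χ x) (extend false v χ y)
                   ℤ.+ pairSlack (c x y) (extend true v χ x) (extend true v χ y))
      ≡⟨ ∑₂-cong xs (λ x y → orientations (χ x) (χ y) (c v x) (c v y) (c x y)) ⟩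
    ∑₂ xs (λ x y → gain (c v x) (c v y) (c x y) ℤ.+ + 2 ℤ.* inner x y)
      ≡⟨ ∑₂-+ xs _ _ ⟩
    totalGain xs v ℤ.+ ∑₂ xs (λ x y → + 2 ℤ.* inner x y)
      ≡⟨ cong (ℤ._+_ (totalGain xs v)) (∑₂-*ˡ xs (+ 2) inner) ⟩
    totalGain xs v ℤ.+ + 2 ℤ.* ∑₂ xs inner
      -- The two blue indicators in `inner` restrict the double sum to the blue neighbours of `v`.
      ≡⟨ cong (λ t → totalGain xs v ℤ.+ + 2 ℤ.* t) (∑₂-filter (λ x → c v x Fin.≟ blue) xs _) ⟨
    totalGain xs v ℤ.+ + 2 ℤ.* slack (blueNbrs v xs) χ ∎
    where
    open ≡-Reasoning
    inner : A → A → ℤ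
    inner x y = is blue (c v x) ℤ.* (is blue (c v y) ℤ.* pairSlack (c x y) (χ x) (χ y))

  -- The diagonal is coloured `none`, so the filter drops `v` itself.
  blueNbrs-shorter : ∀ {v xs} → v ∈ xs → length (blueNbrs v xs) < length xs
  blueNbrs-shorter {v} {xs} v∈xs = filter-notAll (λ x → c v x Fin.≟ blue) xs
    (Any.map (λ { refl vv → contradiction (trans (sym (c-diag v)) vv) λ () }) v∈xs)

  -- The slacks of the two orientations have a nonnegative sum, so one of them is nonnegative.
  extend-nonneg : ∀ xs v χ → 0ℤ ℤ.≤ totalGain xs v → 0ℤ ℤ.≤ slack (blueNbrs v xs) χ →
    ∃ λ χ′ → 0ℤ ℤ.≤ slack xs χ′
  extend-nonneg xs v χ 0≤gain 0≤slack =
    [ extend false v χ ,_ , extend true v χ ,_ ]′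
      (0≤+⇒0≤⊎0≤ (slack xs (extend false v χ)) (slack xs (extend true v χ))
        (subst (0ℤ ℤ.≤_) (sym (slack-extend xs v χ))
          (ℤ.+-mono-≤ 0≤gain (ℤ.*-monoˡ-≤-nonNeg (+ 2) 0≤slack))))

  goodCut-acc : ∀ xs → Acc _<_ (length xs) → ∃ λ χ → 0ℤ ℤ.≤ slack xs χ
  goodCut-acc []           _         = (λ _ → true) , ℤ.≤-refl
  goodCut-acc xs@(x ∷ xs′) (acc rec) =
    let v , v∈xs , 0≤gain = ∑-nonneg⇒∃ x xs′ (totalGain xs) (totalGain-sum-nonneg xs)
        χ , 0≤slack       = goodCut-acc (blueNbrs v xs) (rec (blueNbrs-shorter v∈xs))
    in extend-nonneg xs v χ 0≤gain 0≤slack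

  goodCut : ∀ xs → ∃ λ χ → 0ℤ ℤ.≤ slack xs χ
  goodCut xs = goodCut-acc xs (<-wellFounded _)

-- Edge sets

∑-sum-map : ∀ (xs : List A) (f : A → ℕ) → + sum (map f xs) ≡ ∑ xs (λ x → + f x)
∑-sum-map []       f = refl
∑-sum-map (x ∷ xs) f = cong (ℤ._+_ (+ f x)) (∑-sum-map xs f)

∑-sum-concatMap : ∀ (xs : List A) (f : A → List ℕ) →
  + sum (concatMap f xs) ≡ ∑ xs (λ x → + sum (f x))
∑-sum-concatMap []       f = refl
∑-sum-concatMap (x ∷ xs) f =
  trans (cong +_ (sum-++ (f x) (concatMap f xs))) (cong (ℤ._+_ (+ sum (f x))) (∑-sum-concatMap xs f))

module _ {n} {G : Graph n} (M : EdgeSet G) where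

  size-∑ : + size M ≡ ∑₂ (allFin n) (λ i j → + b2n (⌊ i <? j ⌋ ∧ mem M i j))
  size-∑ = trans (∑-sum-concatMap (allFin n) _) (∑-cong (allFin n) λ i → ∑-sum-map (allFin n) _)

  -- At most one of `i < j` and `j < i` holds. On the diagonal both tests fail, which the inequality
  -- allows.
  ordered-pair : ∀ i j →
    + b2n (⌊ i <? j ⌋ ∧ mem M i j) ℤ.+ + b2n (⌊ j <? i ⌋ ∧ mem M j i) ℤ.≤ + b2n (mem M i j)
  ordered-pair i j rewrite memSym M j i with mem M i j | i <? j | j <? i
  ... | true  | yes i<j | yes j<i = contradiction j<i (ℕ.<-asym i<j)
  ... | true  | yes _   | no _    = ℤ.≤-refl
  ... | true  | no _    | yes _   = ℤ.≤-refl
  ... | true  | no _    | no _    = +≤+ z≤n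
  ... | false | yes _   | yes _   = ℤ.≤-refl
  ... | false | yes _   | no _    = ℤ.≤-refl
  ... | false | no _    | yes _   = ℤ.≤-refl
  ... | false | no _    | no _    = ℤ.≤-refl

  size-≤-∑ : + 2 ℤ.* + size M ℤ.≤ ∑₂ (allFin n) (λ i j → + b2n (mem M i j))
  size-≤-∑ = begin
    + 2 ℤ.* + size M            ≡⟨ double (+ size M) ⟩
    + size M ℤ.+ + size M       ≡⟨ cong₂ ℤ._+_ size-∑ (trans size-∑ (∑-swap (allFin n) (allFin n) u)) ⟩
    ∑₂ (allFin n) u ℤ.+ ∑₂ (allFin n) (λ i j → u j i)
                                ≡⟨ ∑₂-+ (allFin n) u (λ i j → u j i) ⟨
    ∑₂ (allFin n) (λ i j → u i j ℤ.+ u j i)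
                                ≤⟨ ∑₂-mono (allFin n) ordered-pair ⟩
    ∑₂ (allFin n) (λ i j → + b2n (mem M i j)) ∎
    where
    open ℤ.≤-Reasoning
    u : Fin n → Fin n → ℤ
    u i j = + b2n (⌊ i <? j ⌋ ∧ mem M i j)
    double : ∀ a → + 2 ℤ.* a ≡ a ℤ.+ a
    double = solve-∀

agree-comm : ∀ a b → agree a b ≡ agree b a
agree-comm true  true  = refl
agree-comm true  false = refl
agree-comm false true  = refl
agree-comm false false = refl

agree-refl : ∀ a → agree a a ≡ true
agree-refl true  = refl
agree-refl false = refl

uncut : ∀ {n} (G : Graph n) → (Fin n → Bool) → EdgeSet G
uncut G χ = record
  { mem    = λ i j → adj G i j ∧ agree (χ i) (χ j)
  ; memSym = λ i j → cong₂ _∧_ (adj-sym G i j) (agree-comm (χ i) (χ j))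
  ; sub    = λ i j → ∧-true (adj G i j)
  }
  where
  ∧-true : ∀ a {b} → a ∧ b ≡ true → a ≡ true
  ∧-true true _ = refl

uncut-bipartite : ∀ {n} (G : Graph n) χ → BipartiteAfterDeleting (uncut G χ)
uncut-bipartite G χ = χ , λ i j ij cut same →
  contradiction (trans (sym cut) (cong₂ _∧_ ij (trans (cong (agree (χ i)) (sym same)) (agree-refl (χ i))))) λ ()

-- The colouring given by a triangle-independent set

module _ {n} (G : Graph n) (F : EdgeSet G) (F-indep : TriangleIndependent F) where

  pairColour : Bool → Bool → Colour
  pairColour true  _     = red
  pairColour false true  = blue
  pairColour false false = none

  colour : Fin n → Fin n → Colour
  colour i j = pairColour (mem F i j) (adj G i j)

  colour-sym : ∀ i j → colour i j ≡ colour j i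
  colour-sym i j = cong₂ pairColour (memSym F i j) (adj-sym G i j)

  nonadjacent⇒none : ∀ i j → adj G i j ≡ false → colour i j ≡ none
  nonadjacent⇒none i j ¬ij with mem F i j in eq
  ... | true  = contradiction (trans (sym ¬ij) (sub F i j eq)) λ ()
  ... | false = cong (pairColour false) ¬ij

  colour-diag : ∀ i → colour i i ≡ none
  colour-diag i = nonadjacent⇒none i i (irrefl G i)

  red⇒mem : ∀ i j → colour i j ≡ red → mem F i j ≡ true
  red⇒mem i j eq with mem F i j | adj G i j
  ... | true  | _ = refl
  red⇒mem i j () | false | true
  red⇒mem i j () | false | false

  -- If jk were an edge, then j, i, k would span a triangle with two edges in `F`.
  colour-tri : ∀ i j k → colour i j ≡ red → colour i k ≡ red → colour j k ≡ none
  colour-tri i j k ij ik with adj G j k in jk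
  ... | false = trans (cong (pairColour (mem F j k)) (sym jk)) (nonadjacent⇒none j k jk)
  ... | true  = contradiction
    (F-indep j i k (sub F j i ji∈F) (sub F i k ik∈F) jk) two
    where
    ji∈F : mem F j i ≡ true
    ji∈F = trans (memSym F j i) (red⇒mem i j ij)
    ik∈F : mem F i k ≡ true
    ik∈F = red⇒mem i k ik
    two : b2n (mem F j i) + b2n (mem F i k) + b2n (mem F j k) ≰ 1
    two le rewrite ji∈F | ik∈F with le
    ... | s≤s ()

  open Cut colour colour-sym colour-diag colour-tri

  -- The right side is linear in the two membership indicators, so its double sum splits into n² and
  -- the two edge counts.
  pairSlack-colour : ∀ χ i j → pairSlack (colour i j) (χ i) (χ j)
    ≡ 1ℤ ℤ.+ (ℤ.- + 2 ℤ.* + b2n (mem F i j) ℤ.+ ℤ.- + 2 ℤ.* + b2n (mem (uncut G χ) i j))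
  pairSlack-colour χ i j with mem F i j in Fij | adj G i j in Gij | agree (χ i) (χ j)
  ... | true  | true  | true  = refl
  ... | true  | true  | false = refl
  ... | true  | false | _     = contradiction (trans (sym Gij) (sub F i j Fij)) λ ()
  ... | false | true  | true  = refl
  ... | false | true  | false = refl
  ... | false | false | true  = refl
  ... | false | false | false = refl

  quarter-bound : ∃ λ χ → 4 * (size F + size (uncut G χ)) ≤ n * n
  quarter-bound with χ , 0≤slack ← goodCut (allFin n) = χ , ℤ.drop‿+≤+ (begin
    + (4 * (f + u))              ≡⟨ trans (ℤ.pos-* 4 (f + u)) (cong (ℤ._*_ (+ 4)) (ℤ.pos-+ f u)) ⟩
    + 4 ℤ.* (+ f ℤ.+ + u)        ≡⟨ regroup (+ f) (+ u) ⟩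
    + 2 ℤ.* (+ 2 ℤ.* + f ℤ.+ + 2 ℤ.* + u)
      -- Sums over ordered pairs count every edge twice, whence 4 = 2 · 2.
      ≤⟨ ℤ.*-monoˡ-≤-nonNeg (+ 2) (ℤ.+-mono-≤ (size-≤-∑ F) (size-≤-∑ (uncut G χ))) ⟩
    + 2 ℤ.* (ΣF ℤ.+ ΣU)          ≡⟨ ℤ.+-identityʳ _ ⟨
    + 2 ℤ.* (ΣF ℤ.+ ΣU) ℤ.+ 0ℤ   ≤⟨ ℤ.+-monoʳ-≤ (+ 2 ℤ.* (ΣF ℤ.+ ΣU)) 0≤slack ⟩
    + 2 ℤ.* (ΣF ℤ.+ ΣU) ℤ.+ slack V χ
      ≡⟨ cong (ℤ._+_ (+ 2 ℤ.* (ΣF ℤ.+ ΣU))) (slack-sizes χ) ⟩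
    + 2 ℤ.* (ΣF ℤ.+ ΣU) ℤ.+ (+ n ℤ.* + n ℤ.+ (ℤ.- + 2 ℤ.* ΣF ℤ.+ ℤ.- + 2 ℤ.* ΣU))
      ≡⟨ cancel ΣF ΣU (+ n) ⟩
    + n ℤ.* + n                  ≡⟨ ℤ.pos-* n n ⟨
    + (n * n)                    ∎)
    where
    open ℤ.≤-Reasoning
    f = size F
    u = size (uncut G χ)
    V = allFin n
    ΣF = ∑₂ V λ i j → + b2n (mem F i j)
    ΣU = ∑₂ V λ i j → + b2n (mem (uncut G χ) i j)
    regroup : ∀ a b → + 4 ℤ.* (a ℤ.+ b) ≡ + 2 ℤ.* (+ 2 ℤ.* a ℤ.+ + 2 ℤ.* b)
    regroup = solve-∀
    cancel : ∀ a b m → + 2 ℤ.* (a ℤ.+ b) ℤ.+ (m ℤ.* m ℤ.+ (ℤ.- + 2 ℤ.* a ℤ.+ ℤ.- + 2 ℤ.* b)) ≡ m ℤ.* m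
    cancel = solve-∀
    ∑₂-one : ∑₂ V (λ _ _ → 1ℤ) ≡ + n ℤ.* + n
    ∑₂-one = trans (∑₂-product V (λ _ → 1ℤ) (λ _ → 1ℤ))
      (cong₂ ℤ._*_ ∑V ∑V)
      where
      ∑V : ∑ V (λ _ → 1ℤ) ≡ + n
      ∑V = trans (∑-one V) (cong +_ (length-tabulate {n = n} id))
    slack-sizes : ∀ χ → slack V χ ≡ + n ℤ.* + n ℤ.+
      (ℤ.- + 2 ℤ.* ΣF ℤ.+ ℤ.- + 2 ℤ.* ∑₂ V λ i j → + b2n (mem (uncut G χ) i j))
    slack-sizes χ = trans (∑₂-cong V (pairSlack-colour χ)) (trans (∑₂-+ V _ _)
      (cong₂ ℤ._+_ ∑₂-one (trans (∑₂-+ V _ _)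
        (cong₂ ℤ._+_ (∑₂-*ˡ V (ℤ.- + 2) _) (∑₂-*ˡ V (ℤ.- + 2) _)))))

rescale : ∀ {s t m} → t ≤ s → 4 * s ≤ m → 15000 * t ≤ 4403 * m
rescale {s} {t} {m} t≤s 4s≤m = begin
  15000 * t        ≤⟨ ℕ.*-monoʳ-≤ 15000 t≤s ⟩
  -- Since 15000 = 3750 · 4, the bound n²/4 is 3750 n²/15000.
  15000 * s        ≡⟨ ℕ.*-assoc 3750 4 s ⟩
  3750 * (4 * s)   ≤⟨ ℕ.*-monoʳ-≤ 3750 4s≤m ⟩
  3750 * m         ≤⟨ ℕ.*-monoˡ-≤ m (toWitness {a? = 3750 ℕ.≤? 4403} _) ⟩
  4403 * m         ∎
  where open ℕ.≤-Reasoning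

theorem5p3 : ∀ (n : ℕ) (G : Graph n) (a t : ℕ) → IsAlpha1 G a → IsTauB G t →
    15000 * (a + t) ≤ 4403 * (n * n)
theorem5p3 n G a t ((F , F-indep , refl) , _) (_ , t-min) =
  -- `F` attains `a`, and deleting the uncut edges of `χ` leaves a bipartite graph, so their number
  -- is at least `t`.
  let χ , bound = quarter-bound G F F-indep
  in rescale (ℕ.+-monoʳ-≤ (size F) (t-min (uncut G χ) (uncut-bipartite G χ))) bound
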